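{- For every integer $n\geq 4$, the pancake graph $P_n$ is super-connected; that is, every minimum vertex cut of $P_n$ is the neighbor set of a single vertex of $P_n$.
   Context: For $n\ge 2$ and $2\leq j\leq n$, let $r_{1j}\in S_n$ be the prefix reversal, i.e. the permutation of $\{1,\dots,n\}$ with $r_{1j}(k)=j+1-k$ for $1\leq k\leq j$ and $r_{1j}(k)=k$ for $j<k\leq n$. Let $PR_n=\{r_{1j}: 2\leq j\leq n\}$. The pancake graph $P_n$ is the Cayley graph $\mathrm{Cay}(S_n,PR_n)$: the simple undirected graph with vertex set the symmetric group $S_n$ and edges $\{g,gs\}$ for $g\in S_n$, $s\in PR_n$, where products of permutations are composed as $(gs)(k)=g(s(k))$. A graph $X$ is super-connected if each minimum vertex cut (a vertex set of minimum cardinality whose removal disconnects $X$) is the set of neighbors of a single vertex of $X$. -}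

module Defs where

open import Algebra.Bundles using (Group)
import Algebra.Properties.Group as GroupProperties
open import Data.Fin.Base using (Fin; toℕ; fromℕ<)
open import Data.Fin.Permutation
  using (Permutation′; permutation; _⟨$⟩ʳ_; _⟨$⟩ˡ_; _∘ₚ_; flip; inverseˡ; inverseʳ)
  renaming (_≈_ to _≈ₚ_; id to idₚ)
open import Data.Fin.Properties using (toℕ-fromℕ<; toℕ-injective)
open import Data.List.Base using (List; length)
import Data.List.Membership.Setoid as Membership
import Data.List.Relation.Unary.Unique.Setoid as UniqueSetoid
open import Data.Nat.Base using (ℕ; suc; _∸_; _≤_; _<_; z<s; s≤s)
open import Data.Nat.Properties
  using (_<?_; ≤-trans; m∸n≤m; m∸[m∸n]≡n; 0≢1+n)
open import Data.Product.Base using (Σ; ∃; ∃-syntax; _×_; _,_; proj₁; proj₂)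
open import Data.Sum.Base using (_⊎_; inj₁; inj₂)
open import Function.Bundles using (_⇔_)
open import Level using (Level; _⊔_; 0ℓ) renaming (suc to lsuc)
open import Relation.Binary.Bundles using (Setoid)
import Relation.Binary.Construct.On as On
open import Relation.Binary.Core using (Rel)
open import Relation.Binary.Definitions using (Symmetric; _Respects₂_)
open import Relation.Binary.PropositionalEquality
  using (_≡_; refl; sym; trans; cong; subst)
open import Relation.Nullary using (¬_; yes; no; contradiction)
open import Relation.Unary using (Pred)

private
  variable
    c ℓ e p : Level

-- Simple undirected graphs.  Vertices form a setoid because equality of
-- permutations is pointwise.

record Graph c ℓ e : Set (lsuc (c ⊔ ℓ ⊔ e)) where
  infix 4 _~_
  field
    vertices : Setoid c ℓ
  open Setoid vertices public
    using (_≈_; _≉_) renaming (Carrier to Vertex)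
  field
    _~_      : Rel Vertex e
    ~-resp-≈ : _~_ Respects₂ _≈_
    ~-sym    : Symmetric _~_
    ~-irrefl : ∀ {u v} → u ≈ v → ¬ (u ~ v)

module _ (X : Graph c ℓ e) where
  open Graph X

  -- The empty walk may join two ≈-equal representatives of one vertex.
  data Walk : Rel Vertex (c ⊔ ℓ ⊔ e) where
    stop : ∀ {u v} → u ≈ v → Walk u v
    step : ∀ {u v w} → u ~ v → Walk v w → Walk u w

  Disconnected : Set (c ⊔ ℓ ⊔ e)
  Disconnected = ∃[ u ] ∃[ v ] ¬ Walk u v

  open UniqueSetoid vertices using (Unique)
  open Membership vertices using (_∈_; _∉_)

  -- Finite sets of vertices: lists without repetitions up to ≈, so that the
  -- cardinality is the length.
  VertexSet : Set (c ⊔ ℓ)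
  VertexSet = Σ (List Vertex) Unique

  infix 4 _∈ᵥ_ _∉ᵥ_

  _∈ᵥ_ _∉ᵥ_ : Vertex → VertexSet → Set (c ⊔ ℓ)
  v ∈ᵥ C = v ∈ proj₁ C
  v ∉ᵥ C = v ∉ proj₁ C

  card : VertexSet → ℕ
  card C = length (proj₁ C)

  remove : VertexSet → Graph (c ⊔ ℓ) ℓ e
  remove C = record
    { vertices = On.setoid {B = ∃ (_∉ᵥ C)} vertices proj₁
    ; _~_      = λ u v → proj₁ u ~ proj₁ v
    ; ~-resp-≈ = (λ eq → proj₁ ~-resp-≈ eq) , (λ eq → proj₂ ~-resp-≈ eq)
    ; ~-sym    = ~-sym
    ; ~-irrefl = ~-irrefl
    }

module _ (X : Graph c ℓ e) where
  open Graph X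

  IsVertexCut : VertexSet X → Set (c ⊔ ℓ ⊔ e)
  IsVertexCut C = Disconnected (remove X C)

  IsMinimumVertexCut : VertexSet X → Set (c ⊔ ℓ ⊔ e)
  IsMinimumVertexCut C =
    IsVertexCut C × (∀ D → IsVertexCut D → card X C ≤ card X D)

  IsNeighbourSet : VertexSet X → Vertex → Set (c ⊔ ℓ ⊔ e)
  IsNeighbourSet C v = ∀ w → _∈ᵥ_ X w C ⇔ (v ~ w)

  SuperConnected : Set (c ⊔ ℓ ⊔ e)
  SuperConnected = ∀ C → IsMinimumVertexCut C → ∃[ v ] IsNeighbourSet C v

module _ (G : Group c ℓ) where
  private module G = Group G
  open Group G using (Carrier; _≈_; _∙_; ε; setoid; ∙-congʳ)
  open GroupProperties G using (∙-cancelˡ)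

  private
    fixes⇒ε : ∀ {g s} → g ≈ g ∙ s → s ≈ ε
    fixes⇒ε {g} {s} g≈gs =
      ∙-cancelˡ g s ε (G.trans (G.sym g≈gs) (G.sym (G.identityʳ g)))

  -- The edge {g , g s} is recorded in both orientations, so S need not be
  -- closed under inverses.
  Cay : (S : Pred Carrier p) → (∀ {s} → S s → ¬ (s ≈ ε)) → Graph c ℓ (c ⊔ ℓ ⊔ p)
  Cay S S-nontrivial = record
    { vertices = setoid
    ; _~_      = λ g h → ∃[ s ] S s × (h ≈ g ∙ s ⊎ g ≈ h ∙ s)
    ; ~-resp-≈ =
        (λ { h≈h′ (s , s∈S , inj₁ h≈gs) →
               s , s∈S , inj₁ (G.trans (G.sym h≈h′) h≈gs)
           ; h≈h′ (s , s∈S , inj₂ g≈hs) →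
               s , s∈S , inj₂ (G.trans g≈hs (∙-congʳ h≈h′)) })
      , (λ { g≈g′ (s , s∈S , inj₁ h≈gs) →
               s , s∈S , inj₁ (G.trans h≈gs (∙-congʳ g≈g′))
           ; g≈g′ (s , s∈S , inj₂ g≈hs) →
               s , s∈S , inj₂ (G.trans (G.sym g≈g′) g≈hs) })
    ; ~-sym    = λ { (s , s∈S , inj₁ h≈gs) → s , s∈S , inj₂ h≈gs
                   ; (s , s∈S , inj₂ g≈hs) → s , s∈S , inj₁ g≈hs }
    ; ~-irrefl = λ { g≈h (s , s∈S , inj₁ h≈gs) →
                       S-nontrivial s∈S (fixes⇒ε (G.trans g≈h h≈gs))
                   ; g≈h (s , s∈S , inj₂ g≈hs) →
                       S-nontrivial s∈S (fixes⇒ε (G.trans (G.sym g≈h) g≈hs)) }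
    }

-- _∘ₚ_ composes from left to right, hence the swap: (g ∙ s)(k) = g (s k).

Sym : ℕ → Group 0ℓ 0ℓ
Sym n = record
  { Carrier = Permutation′ n
  ; _≈_     = _≈ₚ_
  ; _∙_     = λ g s → s ∘ₚ g
  ; ε       = idₚ
  ; _⁻¹     = flip
  ; isGroup = record
    { isMonoid = record
      { isSemigroup = record
        { isMagma = record
          { isEquivalence = record
            { refl  = λ _ → refl
            ; sym   = λ π≈ρ k → sym (π≈ρ k)
            ; trans = λ π≈ρ ρ≈σ k → trans (π≈ρ k) (ρ≈σ k)
            }
          ; ∙-cong = λ {g} {g′} {s} {s′} g≈g′ s≈s′ k →
              trans (cong (g ⟨$⟩ʳ_) (s≈s′ k)) (g≈g′ (s′ ⟨$⟩ʳ k))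
          }
        ; assoc = λ _ _ _ _ → refl
        }
      ; identity = (λ _ _ → refl) , (λ _ _ → refl)
      }
    ; inverse = (λ g _ → inverseˡ g) , (λ g _ → inverseʳ g)
    ; ⁻¹-cong = λ {g} {h} g≈h k →
        trans (cong (g ⟨$⟩ˡ_) (sym (trans (g≈h (h ⟨$⟩ˡ k)) (inverseʳ h))))
              (inverseˡ g)
    }
  }

module _ {n : ℕ} where

  private
    image<n : ∀ {j k} → j ≤ n → k < j → j ∸ suc k < n
    image<n {suc j} {k} j≤n _ = ≤-trans (s≤s (m∸n≤m j k)) j≤n

  -- Positions count from 0: the 1-based rule k ↦ j + 1 - k becomes
  -- k ↦ j - 1 - k.
  reversePrefix : (j : ℕ) → j ≤ n → Fin n → Fin n
  reversePrefix j j≤n k with toℕ k <? j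
  ... | yes k<j = fromℕ< (image<n j≤n k<j)
  ... | no  _   = k

  toℕ-reversePrefix-< : ∀ {j} (j≤n : j ≤ n) k → toℕ k < j →
                        toℕ (reversePrefix j j≤n k) ≡ j ∸ suc (toℕ k)
  toℕ-reversePrefix-< {j} j≤n k k<j with toℕ k <? j
  ... | yes k<j′ = toℕ-fromℕ< (image<n j≤n k<j′)
  ... | no  k≮j  = contradiction k<j k≮j

  reversePrefix-≥ : ∀ {j} (j≤n : j ≤ n) k → ¬ (toℕ k < j) →
                    reversePrefix j j≤n k ≡ k
  reversePrefix-≥ {j} j≤n k k≮j with toℕ k <? j
  ... | yes k<j = contradiction k<j k≮j
  ... | no  _   = refl

  private
    reflect< : ∀ {j k} → k < j → j ∸ suc k < j
    reflect< {suc j} {k} _ = s≤s (m∸n≤m j k)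

    reflect-involutive : ∀ {j k} → k < j → j ∸ suc (j ∸ suc k) ≡ k
    reflect-involutive {suc j} (s≤s k≤j) = m∸[m∸n]≡n k≤j

  reversePrefix-involutive : ∀ {j} (j≤n : j ≤ n) k →
                             reversePrefix j j≤n (reversePrefix j j≤n k) ≡ k
  reversePrefix-involutive {j} j≤n k = helper (toℕ k <? j)
    where
    k′ = reversePrefix j j≤n k
    helper : _ → reversePrefix j j≤n k′ ≡ k
    helper (no k≮j) =
      trans (cong (reversePrefix j j≤n) (reversePrefix-≥ j≤n k k≮j))
            (reversePrefix-≥ j≤n k k≮j)
    helper (yes k<j) = toℕ-injective
      (trans (toℕ-reversePrefix-< j≤n k′ (subst (_< j) (sym eq) (reflect< k<j)))
        (trans (cong (λ i → j ∸ suc i) eq) (reflect-involutive k<j)))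
      where
      eq : toℕ k′ ≡ j ∸ suc (toℕ k)
      eq = toℕ-reversePrefix-< j≤n k k<j

  r₁ : (j : ℕ) → j ≤ n → Permutation′ n
  r₁ j j≤n = permutation (reversePrefix j j≤n) (reversePrefix j j≤n)
    (reversePrefix-involutive j≤n) (reversePrefix-involutive j≤n)

PR : (n : ℕ) → Pred (Permutation′ n) 0ℓ
PR n s = ∃[ j ] 2 ≤ j × Σ (j ≤ n) λ j≤n → s ≈ₚ r₁ j j≤n

PR-nontrivial : ∀ {n} {s : Permutation′ n} → PR n s → ¬ (s ≈ₚ idₚ)
PR-nontrivial {suc n} (suc (suc j) , s≤s (s≤s _) , j≤n , s≈r) s≈id =
  0≢1+n (trans (cong toℕ (trans (sym (s≈id Fin.zero)) (s≈r Fin.zero)))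
               (toℕ-reversePrefix-< j≤n Fin.zero z<s))

Pancake : (n : ℕ) → Graph 0ℓ 0ℓ 0ℓ
Pancake n = Cay (Sym n) (PR n) (λ {s} → PR-nontrivial {s = s})

{-# OPTIONS --safe #-}

-- P_n splits into blocks according to the last entry; a block is a copy of
-- P_{n-1}, and the only edge leaving it at g goes to g r_{1n}, whose last entry
-- is g(1).  Let F have at most n - 1 vertices.  By induction, a block with at
-- most n - 3 faults stays connected.  Two such blocks b and c are joined by n
-- routes such that no vertex can spoil two of them: two direct edges (only one if
-- n = 3), and for each of the n - 2 other entries d a route through block d.  So
-- some route survives.  If a block has more than n - 3 faults, at most one fault
-- lies outside it; hence each of its remaining vertices g escapes to another
-- block, directly or after one step inside the block, unless all neighbours of g
-- are in F.  When F has at most n - 2 vertices the latter is impossible, which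
-- carries the induction.  Finally the neighbour set of the identity is a cut, so
-- a minimum cut has at most n - 1 vertices, and it equals N(g) once it contains it.

module Submission where

open import Defs
open import Algebra.Bundles using (Group)
open import Data.Fin.Base using (Fin; zero; suc; toℕ; fromℕ<; inject≤)
open import Data.Fin.Permutation
  using (Permutation′; transpose; _⟨$⟩ʳ_; _⟨$⟩ˡ_; inverseˡ; inverseʳ)
import Data.Fin.Permutation.Components as Components
open import Data.Fin.Properties
  using ( _≟_; any?; all?; ¬∀⟶∃¬; injective⇒≤; toℕ-injective; toℕ<n
        ; toℕ-fromℕ<; toℕ-inject≤; inject≤-injective; 0≢1+n)
  renaming (suc-injective to Fin-suc-injective)
open import Data.List.Base using (List; []; _∷_; length; filter; map; tabulate)
import Data.List.Membership.DecPropositional as DecPropositionalMembership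
import Data.List.Membership.DecSetoid as DecMembership
open import Data.List.Membership.Propositional using (find)
open import Data.List.Membership.Propositional.Properties using (∈-map⁺)
import Data.List.Membership.Setoid as Membership
open import Data.List.Membership.Setoid.Properties
  using (index-injective; ∈-filter⁺; ∈-filter⁻; ∈-resp-≈; ∈-tabulate⁺; ∈-tabulate⁻)
open import Data.List.Properties using (length-map; length-tabulate; filter-none)
import Data.List.Relation.Unary.All as All
open import Data.List.Relation.Unary.Any using (Any; here; there; index)
import Data.List.Relation.Unary.Any as Any
import Data.List.Relation.Unary.Unique.Setoid.Properties as Unique
open import Data.Nat.Base using (ℕ; zero; suc; pred; _+_; _≤_; _<_; z≤n; s≤s; z<s)
open import Data.Nat.Properties
  using ( _<?_; _≤?_; ≤-refl; ≤-trans; ≤-reflexive; ≤-irrelevant; ≤-pred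
        ; n≤1+n; n∸n≡0; m≤n⇒m<n∨m≡n; m≤n⇒m≤1+n; 1+n≰n; ≮⇒≥; ≰⇒>; <⇒≱
        ; +-suc; +-monoʳ-≤; +-cancelʳ-≤)
open import Data.Product.Base using (∃; ∃₂; _×_; _,_; proj₁; proj₂)
open import Data.Sum.Base using (_⊎_; inj₁; inj₂; [_,_]′)
open import Function.Base using (_∘_)
open import Function.Bundles using (mk⇔)
open import Level using (0ℓ)
open import Relation.Binary.Bundles using (Setoid; DecSetoid)
open import Relation.Binary.Construct.Closure.ReflexiveTransitive
  using (Star; ε; _◅_; _◅◅_; reverse)
open import Relation.Binary.Core using (Rel)
open import Relation.Binary.PropositionalEquality
  using (_≡_; _≢_; refl; sym; trans; cong; subst)
  renaming (setoid to ≡-setoid)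
open import Relation.Nullary using (¬_; Dec; yes; no; contradiction)
open import Relation.Nullary.Decidable
  using (_×-dec_; _⊎-dec_; ¬?; dec-true; dec-false; decidable-stable)
open import Relation.Unary using (Pred; Decidable)

-- Counting in lists, and a four-way case distinction.

injection⇒≤length : ∀ {a ℓ} (S : Setoid a ℓ) → let open Setoid S; open Membership S in
  ∀ {m xs} {f : Fin m → Carrier} →
  (∀ {i j} → f i ≈ f j → i ≡ j) → (∀ i → f i ∈ xs) → m ≤ length xs
injection⇒≤length S f-inj f∈ =
  injective⇒≤ {f = λ i → index (f∈ i)}
    (λ {i} {j} eq → f-inj (index-injective S (f∈ i) (f∈ j) eq))

length-filter-disjoint : ∀ {a p q} {A : Set a} {P : Pred A p} {Q : Pred A q}
  (P? : Decidable P) (Q? : Decidable Q) → (∀ {x} → P x → ¬ Q x) →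
  ∀ xs → length (filter P? xs) + length (filter Q? xs) ≤ length xs
length-filter-disjoint P? Q? disj [] = z≤n
length-filter-disjoint P? Q? disj (x ∷ xs)
  with ih ← length-filter-disjoint P? Q? disj xs | P? x | Q? x
... | yes px | yes qx = contradiction qx (disj px)
... | yes px | no _   = s≤s ih
... | no _   | yes qx = ≤-trans (≤-reflexive (+-suc _ _)) (s≤s ih)
... | no _   | no _   = m≤n⇒m≤1+n ih

at-most-one : ∀ {a ℓ} (S : Setoid a ℓ) → let open Setoid S; open Membership S in
  ∀ {x y xs} → length xs ≤ 1 → x ∈ xs → y ∈ xs → x ≈ y
at-most-one S {xs = _ ∷ []} _ (here x≈z) (here y≈z) = Setoid.trans S x≈z (Setoid.sym S y≈z)
at-most-one S {xs = _ ∷ _ ∷ _} (s≤s ())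

n≤1+pred[n] : ∀ n → n ≤ suc (pred n)
n≤1+pred[n] zero    = z≤n
n≤1+pred[n] (suc n) = ≤-refl

module _ {a b c d} {A : Set a} {B : Set b} {C : Set c} {D : Set d} where

  -- The shape of `ρ` below. With the decisions as arguments, the four lemmas compute a label from
  -- proofs of the outcomes alone.
  select : Dec A → Dec B → Dec C → D → D → D → D → D
  select (no _)  _       _       w x y z = w
  select (yes _) (no _)  _       w x y z = x
  select (yes _) (yes _) (yes _) w x y z = y
  select (yes _) (yes _) (no _)  w x y z = z

  select-first : ∀ (a? : Dec A) (b? : Dec B) (c? : Dec C) {w x y z} → ¬ A →
                 select a? b? c? w x y z ≡ w
  select-first (yes a) _ _ ¬a = contradiction a ¬a
  select-first (no _)  _ _ _  = refl

  select-second : ∀ (a? : Dec A) (b? : Dec B) (c? : Dec C) {w x y z} → A → ¬ B →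
                  select a? b? c? w x y z ≡ x
  select-second (no ¬a) _       _ a _  = contradiction a ¬a
  select-second (yes _) (yes b) _ _ ¬b = contradiction b ¬b
  select-second (yes _) (no _)  _ _ _  = refl

  select-third : ∀ (a? : Dec A) (b? : Dec B) (c? : Dec C) {w x y z} → A → B → C →
                 select a? b? c? w x y z ≡ y
  select-third (no ¬a) _       _       a _ _ = contradiction a ¬a
  select-third (yes _) (no ¬b) _       _ b _ = contradiction b ¬b
  select-third (yes _) (yes _) (no ¬c) _ _ c = contradiction c ¬c
  select-third (yes _) (yes _) (yes _) _ _ _ = refl

  select-fourth : ∀ (a? : Dec A) (b? : Dec B) (c? : Dec C) {w x y z} → A → B → ¬ C →
                  select a? b? c? w x y z ≡ z
  select-fourth (no ¬a) _       _       a _ _  = contradiction a ¬a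
  select-fourth (yes _) (no ¬b) _       _ b _  = contradiction b ¬b
  select-fourth (yes _) (yes _) (yes c) _ _ ¬c = contradiction c ¬c
  select-fourth (yes _) (yes _) (no _)  _ _ _  = refl

-- Transpositions and injectivity of permutations.

module _ {n : ℕ} where

  transpose-left : ∀ (i j : Fin n) → Components.transpose i j i ≡ j
  transpose-left i j rewrite dec-true (i ≟ i) refl = refl

  transpose-other : ∀ {i j k : Fin n} → k ≢ i → k ≢ j →
                    Components.transpose i j k ≡ k
  transpose-other {i} {j} {k} k≢i k≢j
    rewrite dec-false (k ≟ i) k≢i | dec-false (k ≟ j) k≢j = refl

  ⟨$⟩ʳ-injective : ∀ (u : Permutation′ n) {i j} → u ⟨$⟩ʳ i ≡ u ⟨$⟩ʳ j → i ≡ j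
  ⟨$⟩ʳ-injective u eq =
    trans (sym (inverseˡ u)) (trans (cong (u ⟨$⟩ˡ_) eq) (inverseˡ u))

-- The index `i` shows that positions 1 and 2 exist; exchanging them yields the second direct edge
-- between two blocks.
middle-positions : ∀ {q} (i : Fin q) → 2 ≤ toℕ i →
  ∃₂ λ (x y : Fin (suc q)) → toℕ x ≡ 1 × toℕ y ≡ 2
middle-positions (suc (suc i)) _ = suc zero , suc (suc zero) , refl , refl
middle-positions (suc zero) (s≤s ())

-- Prefix reversals, their cosets and fault-avoiding paths.

module PrefixReversals (q : ℕ) where

  open Group (Sym (suc q)) using (_∙_; _≈_; setoid)
  module S = Setoid setoid

  P : Set
  P = Permutation′ (suc q)

  _≈?_ : (u v : P) → Dec (u ≈ v)
  u ≈? v = all? (λ k → (u ⟨$⟩ʳ k) ≟ (v ⟨$⟩ʳ k))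

  decSetoid : DecSetoid 0ℓ 0ℓ
  decSetoid = record
    { isDecEquivalence = record { isEquivalence = S.isEquivalence ; _≟_ = _≈?_ } }

  open DecMembership decSetoid using (_∈_; _∉_; _∈?_; _∉?_)
  open DecPropositionalMembership (_≟_ {suc q}) using ()
    renaming (_∈_ to _∈ₗ_; _∉_ to _∉ₗ_; _∈?_ to _∈ₗ?_)

  -- gen i is the prefix reversal of length i + 2: it exchanges positions 0 and i + 1.
  gen : Fin q → P
  gen i = r₁ (suc (suc (toℕ i))) (s≤s (toℕ<n i))

  gen-zero : ∀ i → gen i ⟨$⟩ʳ zero ≡ suc i
  gen-zero i = toℕ-injective (toℕ-reversePrefix-< (s≤s (toℕ<n i)) zero z<s)

  gen-top : ∀ i → gen i ⟨$⟩ʳ suc i ≡ zero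
  gen-top i = toℕ-injective
    (trans (toℕ-reversePrefix-< (s≤s (toℕ<n i)) (suc i) ≤-refl) (n∸n≡0 (toℕ i)))

  gen-above : ∀ i {k} → suc (toℕ i) < toℕ k → gen i ⟨$⟩ʳ k ≡ k
  gen-above i {k} i<k = reversePrefix-≥ (s≤s (toℕ<n i)) k (λ k<i → <⇒≱ k<i i<k)

  gen-involutive : ∀ i k → gen i ⟨$⟩ʳ (gen i ⟨$⟩ʳ k) ≡ k
  gen-involutive i = reversePrefix-involutive (s≤s (toℕ<n i))

  gen-injective : ∀ u {i j} → u ∙ gen i ≈ u ∙ gen j → i ≡ j
  gen-injective u {i} {j} eq = Fin-suc-injective
    (trans (sym (gen-zero i)) (trans (⟨$⟩ʳ-injective u (eq zero)) (gen-zero j)))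

  ∙gen-cancel : ∀ i u v → u ∙ gen i ≈ v ∙ gen i → u ≈ v
  ∙gen-cancel i u v eq k =
    trans (cong (u ⟨$⟩ʳ_) (sym (gen-involutive i k)))
      (trans (eq (gen i ⟨$⟩ʳ k)) (cong (v ⟨$⟩ʳ_) (gen-involutive i k)))

  -- u and v lie in the same coset of the subgroup permuting positions 0, …, p.
  Agree : ℕ → Rel P 0ℓ
  Agree p u v = ∀ k → p < toℕ k → u ⟨$⟩ʳ k ≡ v ⟨$⟩ʳ k

  agree-sym : ∀ {p u v} → Agree p u v → Agree p v u
  agree-sym u~v k p<k = sym (u~v k p<k)

  agree-gen : ∀ i u → Agree (suc (toℕ i)) (u ∙ gen i) u
  agree-gen i u k i<k = cong (u ⟨$⟩ʳ_) (gen-above i i<k)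

  -- An entry of `v` at a position up to p cannot sit beyond p in `u`, since `v` would then carry it
  -- there as well, hence twice.
  locate : ∀ p {u v} → Agree p u v → ∀ k → toℕ k ≤ p →
           ∃ λ k′ → toℕ k′ ≤ p × u ⟨$⟩ʳ k′ ≡ v ⟨$⟩ʳ k
  locate p {u} {v} u~v k k≤p with p <? toℕ (u ⟨$⟩ˡ (v ⟨$⟩ʳ k))
  ... | no p≮k′ = u ⟨$⟩ˡ (v ⟨$⟩ʳ k) , ≮⇒≥ p≮k′ , inverseʳ u
  ... | yes p<k′ = contradiction
    (subst (λ l → p < toℕ l)
      (⟨$⟩ʳ-injective v (trans (sym (u~v _ p<k′)) (inverseʳ u))) p<k′)
    (λ p<k → <⇒≱ p<k k≤p)

  -- Permutations are equal only pointwise, so `same` passes between representatives of one vertex;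
  -- `flip` is an edge inside the coset.
  data Move (p : ℕ) (u v : P) : Set where
    same : u ≈ v → Move p u v
    flip : ∀ i → toℕ i < p → v ≈ u ∙ gen i → Move p u v

  record Edge (p : ℕ) (F : List P) (u v : P) : Set where
    constructor edge
    field
      source∉ : u ∉ F
      target∉ : v ∉ F
      move    : Move p u v

  Path : ℕ → List P → Rel P 0ℓ
  Path p F = Star (Edge p F)

  edge-sym : ∀ {p F u v} → Edge p F u v → Edge p F v u
  edge-sym {u = u} {v} (edge u∉ v∉ (same u≈v)) =
    edge v∉ u∉ (same (S.sym {u} {v} u≈v))
  edge-sym {u = u} {v} (edge u∉ v∉ (flip i i<p v≈ui)) =
    edge v∉ u∉ (flip i i<p λ k →
      sym (trans (v≈ui (gen i ⟨$⟩ʳ k)) (cong (u ⟨$⟩ʳ_) (gen-involutive i k))))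

  path-sym : ∀ {p F u v} → Path p F u v → Path p F v u
  path-sym = reverse edge-sym

  -- Cosets for level p are copies of P_{p+1}, reached by the generators gen i with i < p.
  Connected : ℕ → ℕ → Set
  Connected p k = ∀ F → length F ≤ k → ∀ {u v} → u ∉ F → v ∉ F →
                  Agree p u v → Path p F u v

  -- Pigeonhole: positions 0 to i carry i + 1 distinct entries, more than `L` can list.
  unhit-position : ∀ (i : Fin (suc q)) (L : List (Fin (suc q))) → length L ≤ toℕ i →
                   ∀ (u : P) → ∃ λ k → toℕ k ≤ toℕ i × u ⟨$⟩ʳ k ∉ₗ L
  unhit-position i L |L|≤i u
    with k , uk∉L ← ¬∀⟶∃¬ (suc (toℕ i)) _ (λ k → (u ⟨$⟩ʳ inject≤ k (toℕ<n i)) ∈ₗ? L)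
      (λ all∈ → 1+n≰n (≤-trans
        (injection⇒≤length (≡-setoid (Fin (suc q)))
          (λ {k} {l} eq → inject≤-injective _ _ k l (⟨$⟩ʳ-injective u eq)) all∈)
        |L|≤i))
    = inject≤ k (toℕ<n i)
    , subst (_≤ toℕ i) (sym (toℕ-inject≤ k (toℕ<n i))) (≤-pred (toℕ<n k)) , uk∉L

  -- Induction step from level p to level p + 1: blocks by the entry at position p + 1.

  module Step (i : Fin q) (ih : Connected (toℕ i) (pred (toℕ i))) (F : List P) where

    p = toℕ i

    top : Fin (suc q)
    top = suc i

    at? : ∀ b (f : P) → Dec (f ⟨$⟩ʳ top ≡ b)
    at? b f = (f ⟨$⟩ʳ top) ≟ b

    block : Fin (suc q) → List P
    block b = filter (at? b) F

    -- The bound is what `ih` tolerates: n - 3 faults for n = p + 2, when p is positive. Faults from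
    -- all cosets with entry `b` at `top` are counted, which bounds those in the block at hand.
    Good : Fin (suc q) → Set
    Good b = length (block b) ≤ pred p

    block⁺ : ∀ {b} g → g ∈ F → g ⟨$⟩ʳ top ≡ b → g ∈ block b
    block⁺ {b} g = ∈-filter⁺ setoid (at? b) (λ eq → trans (sym (eq top))) {v = g}

    block⁻ : ∀ {b} g → g ∈ block b → g ∈ F
    block⁻ {b} g g∈ = proj₁ (∈-filter⁻ setoid (at? b) (λ eq → trans (sym (eq top))) {v = g} g∈)

    move-top : ∀ {u v} → Move p u v → v ⟨$⟩ʳ top ≡ u ⟨$⟩ʳ top
    move-top (same u≈v) = sym (u≈v top)
    move-top {u} (flip j j<p v≈uj) =
      trans (v≈uj top) (agree-gen j u top (s≤s j<p))

    move-weaken : ∀ {u v} → Move p u v → Move (suc p) u v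
    move-weaken (same u≈v) = same u≈v
    move-weaken (flip j j<p v≈uj) = flip j (m≤n⇒m≤1+n j<p) v≈uj

    lift : ∀ {b u v} → u ⟨$⟩ʳ top ≡ b → Path p (block b) u v → Path (suc p) F u v
    lift u-top ε = ε
    lift u-top (_◅_ {u} {w} (edge u∉ w∉ m) π) =
      edge (λ u∈ → u∉ (block⁺ u u∈ u-top)) (λ w∈ → w∉ (block⁺ w w∈ w-top)) (move-weaken m)
      ◅ lift w-top π
      where
      w-top = trans (move-top m) u-top

    block-path : ∀ {u v} → Good (u ⟨$⟩ʳ top) → u ∉ F → v ∉ F → Agree p u v →
                 Path (suc p) F u v
    block-path {u} {v} good u∉ v∉ u~v =
      lift refl (ih _ good (u∉ ∘ block⁻ u) (v∉ ∘ block⁻ v) u~v)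

    agree-top : ∀ {u v} → Agree (suc p) u v → u ⟨$⟩ʳ top ≡ v ⟨$⟩ʳ top → Agree p u v
    agree-top {u} {v} u~v eq k p<k with m≤n⇒m<n∨m≡n p<k
    ... | inj₁ p+1<k = u~v k p+1<k
    ... | inj₂ p+1≡k = subst (λ l → u ⟨$⟩ʳ l ≡ v ⟨$⟩ʳ l) (toℕ-injective p+1≡k) eq

    flip-top : ∀ u → (u ∙ gen i) ⟨$⟩ʳ top ≡ u ⟨$⟩ʳ zero
    flip-top u = cong (u ⟨$⟩ʳ_) (gen-top i)

    flip-zero : ∀ u → (u ∙ gen i) ⟨$⟩ʳ zero ≡ u ⟨$⟩ʳ top
    flip-zero u = cong (u ⟨$⟩ʳ_) (gen-zero i)

    flip-edge : ∀ u → u ∉ F → u ∙ gen i ∉ F → Edge (suc p) F u (u ∙ gen i)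
    flip-edge u u∉ u′∉ = edge u∉ u′∉ (flip i ≤-refl λ _ → refl)

    hop : ∀ {u} h → Good (u ⟨$⟩ʳ top) → u ∉ F → Agree p u h → h ∉ F → h ∙ gen i ∉ F →
          Path (suc p) F u (h ∙ gen i)
    hop h good u∉ u~h h∉ h′∉ = block-path good u∉ h∉ u~h ◅◅ flip-edge h h∉ h′∉ ◅ ε

    -- The transposition is not a step of a path. It names a vertex with a chosen first entry, and
    -- connectivity of the block supplies the path to it.
    bring : P → Fin (suc q) → P
    bring u k = u ∙ transpose zero k

    bring-zero : ∀ u k → bring u k ⟨$⟩ʳ zero ≡ u ⟨$⟩ʳ k
    bring-zero u k = cong (u ⟨$⟩ʳ_) (transpose-left zero k)

    >⇒≢ : ∀ {m} {k l : Fin (suc q)} → toℕ k ≤ m → m < toℕ l → l ≢ k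
    >⇒≢ k≤m m<l refl = <⇒≱ m<l k≤m

    agree-transpose : ∀ u {x y} → toℕ x ≤ p → toℕ y ≤ p → Agree p u (u ∙ transpose x y)
    agree-transpose u x≤p y≤p k p<k =
      cong (u ⟨$⟩ʳ_) (sym (transpose-other (>⇒≢ x≤p p<k) (>⇒≢ y≤p p<k)))

    locate-below : ∀ {u v} → Agree (suc p) u v → ∀ k → toℕ k ≤ suc p →
                   u ⟨$⟩ʳ top ≢ v ⟨$⟩ʳ k →
                   ∃ λ k′ → toℕ k′ ≤ p × u ⟨$⟩ʳ k′ ≡ v ⟨$⟩ʳ k
    locate-below {u} {v} u~v k k≤ ≢top with locate (suc p) {u} {v} u~v k k≤
    ... | k′ , k′≤ , eq with m≤n⇒m<n∨m≡n k′≤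
    ...   | inj₁ k′< = k′ , ≤-pred k′< , eq
    ...   | inj₂ k′≡ = contradiction
      (subst (λ l → u ⟨$⟩ʳ l ≡ v ⟨$⟩ʳ k) (toℕ-injective k′≡) eq) ≢top

    -- The second bound needs a second direct edge between two blocks, hence 2 ≤ p.
    FewFaults : Set
    FewFaults = length F ≤ p ⊎ (2 ≤ p × length F ≤ suc p)

    -- Routes between two good blocks.

    module Routes {u v : P} (u~v : Agree (suc p) u v)
                  (b≢c : u ⟨$⟩ʳ top ≢ v ⟨$⟩ʳ top)
                  (u∉ : u ∉ F) (v∉ : v ∉ F)
                  (b-good : Good (u ⟨$⟩ʳ top)) (c-good : Good (v ⟨$⟩ʳ top))
                  (kc : Fin (suc q)) (kc≤p : toℕ kc ≤ p) (kc-at : u ⟨$⟩ʳ kc ≡ v ⟨$⟩ʳ top)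
                  where

      b c : Fin (suc q)
      b = u ⟨$⟩ʳ top
      c = v ⟨$⟩ʳ top

      End : Fin (suc q) → Set
      End x = x ≡ b ⊎ x ≡ c

      end? : ∀ x → Dec (End x)
      end? x = (x ≟ b) ⊎-dec (x ≟ c)

      bridge : P
      bridge = bring u kc

      OnBridge : P → Set
      OnBridge f = f ≈ bridge ⊎ f ≈ bridge ∙ gen i

      onBridge-resp : ∀ {f g} → f ≈ g → OnBridge f → OnBridge g
      onBridge-resp {f} {g} f≈g (inj₁ eq) = inj₁ (λ k → trans (sym (f≈g k)) (eq k))
      onBridge-resp {f} {g} f≈g (inj₂ eq) = inj₂ (λ k → trans (sym (f≈g k)) (eq k))

      onBridge? : ∀ f → Dec (OnBridge f)
      onBridge? f = (f ≈? bridge) ⊎-dec (f ≈? (bridge ∙ gen i))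

      -- Routes from block b to block c are labelled by entries: d ∉ {b , c} is the
      -- route through block d, b is the direct edge at bridge, and c the direct
      -- edge at bridge with positions 1 and 2 exchanged.  ρ f is the only route
      -- that f can spoil.
      ρ : P → Fin (suc q)
      ρ f = select (end? (f ⟨$⟩ʳ top)) (end? (f ⟨$⟩ʳ zero)) (onBridge? f)
                   (f ⟨$⟩ʳ top) (f ⟨$⟩ʳ zero) b c

      -- If `g` were in `F`, its representative `f` listed there would put the label `d` into
      -- `map ρ F`. The label is computed at `f`, so `hits` ranges over all representatives.
      missed : ∀ {d} g → (∀ f → g ≈ f → ρ f ≡ d) → d ∉ₗ map ρ F → g ∉ F
      missed g hits d∉ g∈ with f , f∈ , g≈f ← find g∈ =
        d∉ (subst (λ x → x ∈ₗ map ρ F) (hits f g≈f) (∈-map⁺ ρ f∈))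

      missed-top : ∀ g → ¬ End (g ⟨$⟩ʳ top) → g ⟨$⟩ʳ top ∉ₗ map ρ F → g ∉ F
      missed-top g ¬end = missed g λ f g≈f →
        trans (select-first (end? (f ⟨$⟩ʳ top)) (end? (f ⟨$⟩ʳ zero)) (onBridge? f)
                (¬end ∘ subst End (sym (g≈f top))))
              (sym (g≈f top))

      missed-zero : ∀ g → End (g ⟨$⟩ʳ top) → ¬ End (g ⟨$⟩ʳ zero) →
                    g ⟨$⟩ʳ zero ∉ₗ map ρ F → g ∉ F
      missed-zero g end ¬end = missed g λ f g≈f →
        trans (select-second (end? (f ⟨$⟩ʳ top)) (end? (f ⟨$⟩ʳ zero)) (onBridge? f)
                (subst End (g≈f top) end) (¬end ∘ subst End (sym (g≈f zero))))
              (sym (g≈f zero))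

      missed-bridge : ∀ g → End (g ⟨$⟩ʳ top) → End (g ⟨$⟩ʳ zero) → OnBridge g →
                      b ∉ₗ map ρ F → g ∉ F
      missed-bridge g end end₀ on = missed g λ f g≈f →
        select-third (end? (f ⟨$⟩ʳ top)) (end? (f ⟨$⟩ʳ zero)) (onBridge? f)
          (subst End (g≈f top) end) (subst End (g≈f zero) end₀)
          (onBridge-resp {g} {f} g≈f on)

      missed-off-bridge : ∀ g → End (g ⟨$⟩ʳ top) → End (g ⟨$⟩ʳ zero) → ¬ OnBridge g →
                          c ∉ₗ map ρ F → g ∉ F
      missed-off-bridge g end end₀ off = missed g λ f g≈f →
        select-fourth (end? (f ⟨$⟩ʳ top)) (end? (f ⟨$⟩ʳ zero)) (onBridge? f)
          (subst End (g≈f top) end) (subst End (g≈f zero) end₀)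
          (off ∘ onBridge-resp {f} {g} (S.sym {g} {f} g≈f))

      agree-flip : ∀ {h w} → Agree p w h → Agree (suc p) w v → Agree (suc p) (h ∙ gen i) v
      agree-flip {h} {w} w~h w~v k p<k =
        trans (agree-gen i h k p<k)
          (trans (sym (w~h k (≤-trans (n≤1+n _) p<k))) (w~v k p<k))

      -- The last leg of every route: move inside the block of `w` to `h`, cross into block `c`,
      -- which is where `h` leads because its first entry is `c`, and continue there to `v`.
      finish : ∀ {w} h → Good (w ⟨$⟩ʳ top) → w ∉ F → Agree p w h → Agree (suc p) w v →
               h ⟨$⟩ʳ zero ≡ c → h ∉ F → h ∙ gen i ∉ F → Path (suc p) F w v
      finish {w} h w-good w∉ w~h w~v h-zero h∉ h′∉ =
        hop {w} h w-good w∉ w~h h∉ h′∉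
        ◅◅ block-path {h ∙ gen i} {v} (subst Good (sym h′-top) c-good) h′∉ v∉
             (agree-top {h ∙ gen i} {v} (agree-flip {h} {w} w~h w~v) h′-top)
        where
        h′-top : (h ∙ gen i) ⟨$⟩ʳ top ≡ c
        h′-top = trans (flip-top h) h-zero

      bring-agree : ∀ w k → toℕ k ≤ p → Agree p w (bring w k)
      bring-agree w k k≤p = agree-transpose w {zero} {k} z≤n k≤p

      bring-top : ∀ w k → toℕ k ≤ p → bring w k ⟨$⟩ʳ top ≡ w ⟨$⟩ʳ top
      bring-top w k k≤p = sym (bring-agree w k k≤p top ≤-refl)

      bridge-zero : bridge ⟨$⟩ʳ zero ≡ c
      bridge-zero = trans (bring-zero u kc) kc-at

      bridge-agree : Agree p u bridge
      bridge-agree = bring-agree u kc kc≤p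

      bridge-top : bridge ⟨$⟩ʳ top ≡ b
      bridge-top = sym (bridge-agree top ≤-refl)

      over-bridge : b ∉ₗ map ρ F → Path (suc p) F u v
      over-bridge b∉ = finish {u} bridge b-good u∉ bridge-agree u~v bridge-zero
        (missed-bridge bridge (inj₁ bridge-top) (inj₂ bridge-zero) (inj₁ λ _ → refl) b∉)
        (missed-bridge (bridge ∙ gen i)
          (inj₂ (trans (flip-top bridge) bridge-zero))
          (inj₁ (trans (flip-zero bridge) bridge-top)) (inj₂ λ _ → refl) b∉)

      -- Positions 1 and 2 lie below `top` and avoid 0, so exchanging them in `bridge` keeps the
      -- block and the first entry `c` but changes the vertex. Both ends of the new edge then have
      -- label `c`.
      second-bridge : 2 ≤ p → c ∉ₗ map ρ F → Path (suc p) F u v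
      second-bridge 2≤p c∉ with x , y , x≡1 , y≡2 ← middle-positions i 2≤p =
        finish {u} h b-good u∉ u~h u~v h-zero
          (missed-off-bridge h (inj₁ h-top) (inj₂ h-zero) h-off c∉)
          (missed-off-bridge (h ∙ gen i) (inj₂ h′-top)
            (inj₁ (trans (flip-zero h) h-top)) h′-off c∉)
        where
        h : P
        h = bridge ∙ transpose x y
        x≤p : toℕ x ≤ p
        x≤p = ≤-trans (≤-reflexive x≡1) (≤-trans (n≤1+n 1) 2≤p)
        y≤p : toℕ y ≤ p
        y≤p = ≤-trans (≤-reflexive y≡2) 2≤p
        u~h : Agree p u h
        u~h k p<k = trans (bridge-agree k p<k) (agree-transpose bridge {x} {y} x≤p y≤p k p<k)
        h-zero : h ⟨$⟩ʳ zero ≡ c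
        h-zero = trans (cong (bridge ⟨$⟩ʳ_) (transpose-other (≢zero x≡1) (≢zero y≡2))) bridge-zero
          where
          ≢zero : ∀ {m} {l : Fin (suc q)} → toℕ l ≡ suc m → zero ≢ l
          ≢zero () refl
        h-top : h ⟨$⟩ʳ top ≡ b
        h-top = sym (u~h top ≤-refl)
        h′-top : (h ∙ gen i) ⟨$⟩ʳ top ≡ c
        h′-top = trans (flip-top h) h-zero
        h≉bridge : ¬ (h ≈ bridge)
        h≉bridge eq with trans (sym x≡1) (trans (cong toℕ (sym y≡x)) y≡2)
          where
          y≡x : y ≡ x
          y≡x = trans (sym (transpose-left x y)) (⟨$⟩ʳ-injective bridge (eq x))
        ... | ()
        h-off : ¬ OnBridge h
        h-off (inj₁ eq) = h≉bridge eq
        -- The far end of the bridge lies in block `c`, whereas `h` lies in block `b`.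
        h-off (inj₂ eq) =
          b≢c (trans (sym h-top) (trans (eq top) (trans (flip-top bridge) bridge-zero)))
        h′-off : ¬ OnBridge (h ∙ gen i)
        h′-off (inj₁ eq) = b≢c (trans (sym bridge-top) (trans (sym (eq top)) h′-top))
        h′-off (inj₂ eq) = h≉bridge (∙gen-cancel i h bridge eq)

      via : ∀ k → toℕ k ≤ p → ¬ End (u ⟨$⟩ʳ k) → u ⟨$⟩ʳ k ∉ₗ map ρ F → Path (suc p) F u v
      via k k≤p ¬end d∉ =
        hop {u} h b-good u∉ (bring-agree u k k≤p) h∉ h′∉
        ◅◅ finish {h′} h₂ h′-good h′∉ (bring-agree h′ k₂ k₂≤p) h′~v h₂-zero h₂∉ h₂′∉
        where
        d : Fin (suc q)
        d = u ⟨$⟩ʳ k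
        h h′ : P
        h = bring u k
        h′ = h ∙ gen i
        h-top : h ⟨$⟩ʳ top ≡ b
        h-top = bring-top u k k≤p
        h-zero : h ⟨$⟩ʳ zero ≡ d
        h-zero = bring-zero u k
        h′-top : h′ ⟨$⟩ʳ top ≡ d
        h′-top = trans (flip-top h) h-zero
        top-missed : ∀ g → g ⟨$⟩ʳ top ≡ d → g ∉ F
        top-missed g eq = missed-top g (¬end ∘ subst End eq) (d∉ ∘ subst (_∈ₗ map ρ F) eq)
        zero-missed : ∀ g → End (g ⟨$⟩ʳ top) → g ⟨$⟩ʳ zero ≡ d → g ∉ F
        zero-missed g end eq =
          missed-zero g end (¬end ∘ subst End eq) (d∉ ∘ subst (_∈ₗ map ρ F) eq)
        h∉ : h ∉ F
        h∉ = zero-missed h (inj₁ h-top) h-zero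
        h′∉ : h′ ∉ F
        h′∉ = top-missed h′ h′-top
        h′~v : Agree (suc p) h′ v
        h′~v = agree-flip {h} {u} (bring-agree u k k≤p) u~v
        h′-good : Good (h′ ⟨$⟩ʳ top)
        -- Every fault in block `d` would have label `d`, so this block contains none.
        h′-good = ≤-trans (≤-reflexive (cong length
          (filter-none (at? (h′ ⟨$⟩ʳ top))
            (All.tabulate λ {f} f∈ eq →
              top-missed f (trans eq h′-top) (∈⇒∈ₛ f∈))))) z≤n
          where
          ∈⇒∈ₛ : ∀ {f xs} → Any (f ≡_) xs → f ∈ xs
          ∈⇒∈ₛ = Any.map λ { refl _ → refl }
        located : ∃ λ k → toℕ k ≤ p × h′ ⟨$⟩ʳ k ≡ c
        located = locate-below {h′} {v} h′~v top ≤-refl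
          (λ eq → ¬end (inj₂ (trans (sym h′-top) eq)))
        k₂ = proj₁ located
        k₂≤p = proj₁ (proj₂ located)
        h₂ : P
        h₂ = bring h′ k₂
        h₂-zero : h₂ ⟨$⟩ʳ zero ≡ c
        h₂-zero = trans (bring-zero h′ k₂) (proj₂ (proj₂ located))
        h₂-top : h₂ ⟨$⟩ʳ top ≡ d
        h₂-top = trans (bring-top h′ k₂ k₂≤p) h′-top
        h₂∉ : h₂ ∉ F
        h₂∉ = top-missed h₂ h₂-top
        h₂′∉ : h₂ ∙ gen i ∉ F
        h₂′∉ = zero-missed (h₂ ∙ gen i) (inj₂ (trans (flip-top h₂) h₂-zero))
          (trans (flip-zero h₂) h₂-top)

      -- The p + 2 entries of `u` up to `top` serve as labels, and each fault spoils one. With at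
      -- most p faults there is room to exclude `c` too; with p + 1 faults `c` may be the survivor,
      -- but then 2 ≤ p allows the second bridge.
      free-label : FewFaults →
                   ∃ λ k → toℕ k ≤ suc p × u ⟨$⟩ʳ k ∉ₗ map ρ F × (u ⟨$⟩ʳ k ≡ c → 2 ≤ p)
      free-label (inj₁ |F|≤p)
        with k , k≤ , uk∉ ← unhit-position top (c ∷ map ρ F)
               (s≤s (≤-trans (≤-reflexive (length-map ρ F)) |F|≤p)) u
        = k , k≤ , uk∉ ∘ there , λ uk≡c → contradiction (here uk≡c) uk∉
      free-label (inj₂ (2≤p , |F|≤))
        with k , k≤ , uk∉ ← unhit-position top (map ρ F)
               (≤-trans (≤-reflexive (length-map ρ F)) |F|≤) u
        = k , k≤ , uk∉ , λ _ → 2≤p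

      route : FewFaults → Path (suc p) F u v
      route bound with k , k≤ , uk∉ , uk≡c⇒ ← free-label bound | end? (u ⟨$⟩ʳ k)
      ... | yes (inj₁ uk≡b) = over-bridge (uk∉ ∘ subst (_∈ₗ map ρ F) (sym uk≡b))
      ... | yes (inj₂ uk≡c) = second-bridge (uk≡c⇒ uk≡c) (uk∉ ∘ subst (_∈ₗ map ρ F) (sym uk≡c))
      ... | no ¬end with m≤n⇒m<n∨m≡n k≤
      ...   | inj₁ k< = via k (≤-pred k<) ¬end uk∉
      ...   | inj₂ k≡ = contradiction
        (inj₁ (cong (u ⟨$⟩ʳ_) (toℕ-injective {i = k} {j = top} k≡))) ¬end

    good-path : FewFaults → ∀ {u v} → Agree (suc p) u v → u ∉ F → v ∉ F →
                Good (u ⟨$⟩ʳ top) → Good (v ⟨$⟩ʳ top) → Path (suc p) F u v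
    good-path few {u} {v} u~v u∉ v∉ u-good v-good with (u ⟨$⟩ʳ top) ≟ (v ⟨$⟩ʳ top)
    ... | yes eq = block-path u-good u∉ v∉ (agree-top {u} {v} u~v eq)
    ... | no b≢c with k , k≤p , uk≡c ← locate-below {u} {v} u~v top ≤-refl b≢c =
      Routes.route {u} {v} u~v b≢c u∉ v∉ u-good v-good k k≤p uk≡c few

    -- Escaping from a block with too many faults.

    outside-small : ∀ {a} {Q : Pred P 0ℓ} (Q? : Decidable Q) → (∀ {f} → Q f → f ⟨$⟩ʳ top ≢ a) →
                    ¬ Good a → ∀ {k} → length F ≤ k + p → length (filter Q? F) ≤ k
    outside-small {a} Q? disj ¬good {k} |F|≤ = +-cancelʳ-≤ (length (block a)) _ _
      (≤-trans (length-filter-disjoint Q? (at? a) disj F)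
        -- A block that is not good holds at least p faults, which leaves at most k of the k + p.
        (≤-trans |F|≤ (+-monoʳ-≤ k (≤-trans (n≤1+pred[n] p) (≰⇒> ¬good)))))

    outside-≤1 : FewFaults → ∀ {a} → ¬ Good a → length (filter (¬? ∘ at? a) F) ≤ 1
    outside-≤1 few ¬good = outside-small (¬? ∘ at? _) (λ ¬eq → ¬eq) ¬good
      ([ m≤n⇒m≤1+n , proj₂ ]′ few)

    -- Another block has no fault in the first case and at most one in the second, where 2 ≤ p makes
    -- one fault tolerable.
    others-good : FewFaults → ∀ {a b} → ¬ Good a → b ≢ a → Good b
    others-good (inj₁ |F|≤p) ¬good b≢a =
      ≤-trans (outside-small (at? _) (λ { refl eq → b≢a eq }) ¬good |F|≤p) z≤n
    others-good (inj₂ (2≤p , |F|≤1+p)) ¬good b≢a =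
      ≤-trans (outside-small (at? _) (λ { refl eq → b≢a eq }) ¬good |F|≤1+p) (≤-pred-mono 2≤p)
      where
      ≤-pred-mono : ∀ {n} → 2 ≤ n → 1 ≤ pred n
      ≤-pred-mono (s≤s 1≤n) = 1≤n

    Isolated : P → Set
    Isolated u = ∀ j → toℕ j ≤ p → u ∙ gen j ∈ F

    record ReachesGood (u : P) : Set where
      constructor reaches
      field
        {goal}  : P
        goal∉   : goal ∉ F
        good    : Good (goal ⟨$⟩ʳ top)
        agree   : Agree (suc p) u goal
        path    : Path (suc p) F u goal

    escape : FewFaults → ∀ u → u ∉ F → ReachesGood u ⊎ Isolated u
    escape few u u∉ with length (block (u ⟨$⟩ʳ top)) ≤? pred p
    ... | yes good = inj₁ (reaches u∉ good (λ _ _ → refl) ε)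
    ... | no ¬good = bad
      where
      a = u ⟨$⟩ʳ top

      flip-leaves : ∀ w → w ⟨$⟩ʳ top ≡ a → (w ∙ gen i) ⟨$⟩ʳ top ≢ a
      flip-leaves w w-top eq =
        0≢1+n (⟨$⟩ʳ-injective w (trans (sym (flip-top w)) (trans eq (sym w-top))))

      flipped-good : ∀ w → w ⟨$⟩ʳ top ≡ a → Good ((w ∙ gen i) ⟨$⟩ʳ top)
      flipped-good w w-top = others-good few ¬good (flip-leaves w w-top)

      agree-flipped : ∀ w → Agree (suc p) w (w ∙ gen i)
      agree-flipped w = agree-sym {u = w ∙ gen i} {w} (agree-gen i w)

      outside⁺ : ∀ g → g ∈ F → g ⟨$⟩ʳ top ≢ a → g ∈ filter (¬? ∘ at? a) F
      outside⁺ g = ∈-filter⁺ setoid (¬? ∘ at? a) (λ f≈g ≢a eq → ≢a (trans (f≈g top) eq)) {v = g}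

      bad : ReachesGood u ⊎ Isolated u
      bad with (u ∙ gen i) ∈? F
      ... | no u′∉ = inj₁ (reaches u′∉ (flipped-good u refl) (agree-flipped u)
                            (flip-edge u u∉ u′∉ ◅ ε))
      ... | yes u′∈ with any? (λ j → (toℕ j <? p) ×-dec ((u ∙ gen j) ∉? F))
      ...   | no none = inj₂ λ j j≤p → decidable-stable ((u ∙ gen j) ∈? F) λ uj∉ →
                [ (λ j<p → none (j , j<p , uj∉))
                , (λ j≡i → uj∉ (subst (λ l → u ∙ gen l ∈ F) (sym (toℕ-injective j≡i)) u′∈))
                ]′ (m≤n⇒m<n∨m≡n j≤p)
      ...   | yes (j , j<p , w∉) = inj₁ (reaches w′∉ (flipped-good w w-top)
                (λ k p<k → trans (u~w k p<k) (agree-flipped w k p<k))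
                (edge u∉ w∉ (flip j (m≤n⇒m≤1+n j<p) (λ _ → refl)) ◅ flip-edge w w∉ w′∉ ◅ ε))
        where
        w : P
        w = u ∙ gen j
        w-top : w ⟨$⟩ʳ top ≡ a
        w-top = agree-gen j u top (s≤s j<p)
        u~w : Agree (suc p) u w
        u~w k p<k = sym (agree-gen j u k (≤-trans (s≤s (m≤n⇒m≤1+n j<p)) p<k))
        w′∉ : w ∙ gen i ∉ F
        -- Two faults outside block `a` must coincide, so `w ∙ gen i` would equal `u ∙ gen i`.
        -- Cancelling gives `u ≈ w`, but `gen j` moves position 0.
        w′∉ w′∈ = 0≢1+n (⟨$⟩ʳ-injective u
          (trans (∙gen-cancel i u w u′≈w′ zero) (cong (u ⟨$⟩ʳ_) (gen-zero j))))
          where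
          u′≈w′ : u ∙ gen i ≈ w ∙ gen i
          u′≈w′ = at-most-one setoid {u ∙ gen i} {w ∙ gen i} (outside-≤1 few ¬good)
            (outside⁺ (u ∙ gen i) u′∈ (flip-leaves u refl))
            (outside⁺ (w ∙ gen i) w′∈ (flip-leaves w w-top))

    -- The isolated alternative is left open: the induction refutes it by counting, and the theorem
    -- reads off the neighbour set from it.
    connected-or-isolated : FewFaults → ∀ {u v} → u ∉ F → v ∉ F → Agree (suc p) u v →
                            Path (suc p) F u v ⊎ ∃ Isolated
    connected-or-isolated few {u} {v} u∉ v∉ u~v with escape few u u∉ | escape few v v∉
    ... | inj₂ u-isolated | _ = inj₂ (u , u-isolated)
    ... | inj₁ _ | inj₂ v-isolated = inj₂ (v , v-isolated)
    ... | inj₁ (reaches {g} g∉ g-good u~g u→g) | inj₁ (reaches {h} h∉ h-good v~h v→h) =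
      inj₁ (u→g ◅◅ good-path few {g} {h} g~h g∉ h∉ g-good h-good ◅◅ path-sym v→h)
      where
      g~h : Agree (suc p) g h
      g~h k p<k = trans (sym (u~g k p<k)) (trans (u~v k p<k) (v~h k p<k))

    isolated⇒large : ∀ {u} → Isolated u → suc p ≤ length F
    isolated⇒large {u} isolated =
      injection⇒≤length setoid {f = λ k → u ∙ gen (inject≤ k (toℕ<n i))}
        (λ {k} {l} eq → inject≤-injective (toℕ<n i) (toℕ<n i) k l (gen-injective u eq))
        (λ k → isolated _
          (≤-trans (≤-reflexive (toℕ-inject≤ k (toℕ<n i))) (≤-pred (toℕ<n k))))

  -- Fault-tolerant connectivity at every level.

  connected : ∀ p → p ≤ q → Connected p (pred p)
  connected zero    _   F _    {u} {v} u∉ v∉ u~v = edge u∉ v∉ (same u≈v) ◅ ε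
    where
    -- A coset of level 0 is a single vertex: agreement at all positions but 0 forces agreement at
    -- 0.
    u≈v : u ≈ v
    u≈v zero with locate 0 {u} {v} u~v zero z≤n
    ... | zero , _ , eq = eq
    u≈v (suc k) = u~v (suc k) z<s
  connected (suc p) p<q F |F|≤p = subst (λ m → ∀ {u v} → u ∉ F → v ∉ F →
      Agree (suc m) u v → Path (suc m) F u v) (toℕ-fromℕ< p<q) path
    where
    i : Fin q
    i = fromℕ< p<q
    |F|≤i : length F ≤ toℕ i
    |F|≤i = subst (length F ≤_) (sym (toℕ-fromℕ< p<q)) |F|≤p
    open Step i (subst (λ m → Connected m (pred m)) (sym (toℕ-fromℕ< p<q))
                  (connected p (≤-trans (n≤1+n p) p<q))) F
    path : ∀ {u v} → u ∉ F → v ∉ F → Agree (suc (toℕ i)) u v → Path (suc (toℕ i)) F u v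
    path {u} {v} u∉ v∉ u~v with connected-or-isolated (inj₁ |F|≤i) {u} {v} u∉ v∉ u~v
    ... | inj₁ π = π
    -- Isolating a vertex takes p + 1 faults, one more than `F` may have.
    ... | inj₂ (g , isolated) = contradiction (≤-trans (isolated⇒large {g} isolated) |F|≤i) 1+n≰n

  -- From coset paths to walks in the pancake graph.

  open Graph (Pancake (suc q)) using (_~_; ~-resp-≈)

  gen-PR : ∀ i → PR (suc q) (gen i)
  gen-PR i = suc (suc (toℕ i)) , s≤s (s≤s z≤n) , s≤s (toℕ<n i) , λ _ → refl

  PR-gen : ∀ {s} → PR (suc q) s → ∃ λ i → s ≈ gen i
  PR-gen {s} (suc (suc j) , _ , s≤s j<q , s≈r) = fromℕ< j<q , λ k →
    trans (s≈r k) (r₁-cong (sym (toℕ-fromℕ< j<q)) (s≤s j<q) (s≤s (toℕ<n (fromℕ< j<q))) k)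
    where
    r₁-cong : ∀ {j l} → j ≡ l → (j≤ : suc (suc j) ≤ suc q) (l≤ : suc (suc l) ≤ suc q) →
              ∀ k → r₁ (suc (suc j)) j≤ ⟨$⟩ʳ k ≡ r₁ (suc (suc l)) l≤ ⟨$⟩ʳ k
    r₁-cong {j} refl j≤ l≤ k = cong (λ j≤ → r₁ (suc (suc j)) j≤ ⟨$⟩ʳ k) (≤-irrelevant j≤ l≤)
  PR-gen (suc zero , s≤s () , _)

  -- Prefix reversals are involutions, so both orientations of an edge amount to right
  -- multiplication by a generator.
  ~⇒gen : ∀ {u v} → u ~ v → ∃ λ i → v ≈ u ∙ gen i
  ~⇒gen {u} {v} (s , s∈ , inj₁ v≈us) with i , s≈gen ← PR-gen {s} s∈ =
    i , λ k → trans (v≈us k) (cong (u ⟨$⟩ʳ_) (s≈gen k))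
  ~⇒gen {u} {v} (s , s∈ , inj₂ u≈vs) with i , s≈gen ← PR-gen {s} s∈ =
    i , λ k → sym (trans (u≈vs (gen i ⟨$⟩ʳ k))
      (cong (v ⟨$⟩ʳ_) (trans (s≈gen _) (gen-involutive i k))))

  gen⇒~ : ∀ {u v} i → v ≈ u ∙ gen i → u ~ v
  gen⇒~ i v≈ui = gen i , gen-PR i , inj₁ v≈ui

  module _ (C : VertexSet (Pancake (suc q))) where

    -- A walk has no step between equal representatives, so a `same` move is absorbed by changing
    -- the start of the walk that follows.
    walk-resp : ∀ {u v w} → proj₁ u ≈ proj₁ v →
                Walk (remove (Pancake (suc q)) C) v w → Walk (remove (Pancake (suc q)) C) u w
    walk-resp {u , _} {v , _} {w , _} u≈v (stop v≈w) = stop (S.trans {u} {v} {w} u≈v v≈w)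
    walk-resp {u , _} {v , _} {w , _} u≈v (step {v = x , _} v~x walk) =
      step (proj₂ ~-resp-≈ {x} {v} {u} (S.sym {u} {v} u≈v) v~x) walk

    path⇒walk : ∀ {p u v} (u∉ : u ∉ proj₁ C) (v∉ : v ∉ proj₁ C) → Path p (proj₁ C) u v →
                Walk (remove (Pancake (suc q)) C) (u , u∉) (v , v∉)
    path⇒walk u∉ v∉ ε = stop (λ _ → refl)
    path⇒walk u∉ v∉ (edge _ w∉ (same u≈w) ◅ π) = walk-resp u≈w (path⇒walk w∉ v∉ π)
    path⇒walk {u = u} u∉ v∉ (_◅_ {j = w} (edge _ w∉ (flip i _ w≈ui)) π) =
      step (gen⇒~ {u} {w} i w≈ui) (path⇒walk w∉ v∉ π)

    -- The q distinct neighbours of `g` already fill `C`; any other member would make q + 1.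
    isolated⇒neighbourSet : length (proj₁ C) ≤ q → ∀ g → (∀ i → g ∙ gen i ∈ proj₁ C) →
                            IsNeighbourSet (Pancake (suc q)) C g
    isolated⇒neighbourSet |C|≤q g isolated w = mk⇔ to from
      where
      from : g ~ w → w ∈ proj₁ C
      from g~w with i , w≈gi ← ~⇒gen {g} {w} g~w =
        ∈-resp-≈ setoid {x = g ∙ gen i} {w} (S.sym {w} {g ∙ gen i} w≈gi) (isolated i)
      to : w ∈ proj₁ C → g ~ w
      to w∈ with any? (λ i → w ≈? (g ∙ gen i))
      ... | yes (i , w≈gi) = gen⇒~ {g} {w} i w≈gi
      ... | no ≉ = contradiction (≤-trans too-many |C|≤q) 1+n≰n
        where
        vertex : Fin (suc q) → P
        vertex zero    = w
        vertex (suc i) = g ∙ gen i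
        vertex-injective : ∀ {k l} → vertex k ≈ vertex l → k ≡ l
        vertex-injective {zero}  {zero}  _  = refl
        vertex-injective {zero}  {suc l} eq = contradiction (l , eq) ≉
        vertex-injective {suc k} {zero}  eq =
          contradiction (k , S.sym {g ∙ gen k} {w} eq) ≉
        vertex-injective {suc k} {suc l} eq = cong suc (gen-injective g eq)
        vertex∈ : ∀ k → vertex k ∈ proj₁ C
        vertex∈ zero    = w∈
        vertex∈ (suc i) = isolated i
        too-many : suc q ≤ length (proj₁ C)
        too-many = injection⇒≤length setoid {f = vertex} vertex-injective vertex∈

  -- Minimum cuts of the pancake graph.

  id-neighbours : VertexSet (Pancake (suc q))
  id-neighbours =
    tabulate gen , Unique.tabulate⁺ setoid {f = gen} (λ {i} {j} → gen-injective Sₙ.ε)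
    where module Sₙ = Group (Sym (suc q))

theorem2p4 : (n : ℕ) → 4 ≤ n → SuperConnected (Pancake n)
theorem2p4 (suc (suc (suc (suc m)))) (s≤s (s≤s (s≤s (s≤s _)))) C ((u , v , ¬walk) , minimum) =
  [ (λ π → contradiction (path⇒walk C (proj₂ u) (proj₂ v) π) ¬walk)
  , (λ { (g , isolated) → g , isolated⇒neighbourSet C |C|≤q g λ i →
           isolated i (≤-trans (≤-pred (toℕ<n i)) (≤-reflexive (sym p≡))) })
  -- Here p = n - 2 is at least 2 and `C` has at most n - 1 = p + 1 vertices.
  ]′ (connected-or-isolated (inj₂ (subst (2 ≤_) (sym p≡) (s≤s (s≤s z≤n))
                                  , subst (λ k → length (proj₁ C) ≤ suc k) (sym p≡) |C|≤q))
       {proj₁ u} {proj₁ v} (proj₂ u) (proj₂ v)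
       -- No position exceeds p + 1 = q, so the coset is the whole group.
       λ k p<k → contradiction (≤-pred (toℕ<n k)) (<⇒≱ (subst (λ l → suc l < toℕ k) p≡ p<k)))
  where
  q = suc (suc (suc m))
  open PrefixReversals q
  open Group (Sym (suc q)) using (setoid) renaming (ε to id)

  last : Fin q
  last = fromℕ< {suc (suc m)} ≤-refl

  p≡ : toℕ last ≡ suc (suc m)
  p≡ = toℕ-fromℕ< {suc (suc m)} ≤-refl

  -- It fixes position 0, which every neighbour of the identity moves, and it differs from the
  -- identity at position 1.
  remote : Permutation′ (suc q)
  remote = transpose (suc zero) (suc (suc zero))

  ∉neighbours : ∀ w → w ⟨$⟩ʳ zero ≡ zero → ¬ (_∈ᵥ_ (Pancake (suc q)) w id-neighbours)
  ∉neighbours w w-zero w∈ with i , w≈gen ← ∈-tabulate⁻ setoid {f = gen} {v = w} w∈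
    with () ← trans (sym w-zero) (trans (w≈gen zero) (gen-zero i))

  neighbours-cut : IsVertexCut (Pancake (suc q)) id-neighbours
  neighbours-cut = (id , ∉neighbours id refl) , (remote , ∉neighbours remote refl) , no-walk
    where
    no-walk : ¬ Walk (remove (Pancake (suc q)) id-neighbours) _ _
    no-walk (stop id≈remote) with () ← id≈remote (suc zero)
    -- The first step from the identity would already enter the removed set.
    no-walk (step {v = w , w∉} id~w _) with i , w≈gen ← ~⇒gen {id} {w} id~w =
      w∉ (∈-resp-≈ setoid {x = gen i} {w} (λ k → sym (w≈gen k)) (∈-tabulate⁺ setoid {f = gen} i))

  |C|≤q : length (proj₁ C) ≤ q
  |C|≤q = ≤-trans (minimum id-neighbours neighbours-cut) (≤-reflexive (length-tabulate gen))

  open Step last (subst (λ k → Connected k (pred k)) (sym p≡) (connected (suc (suc m)) (n≤1+n _)))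
    (proj₁ C)
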